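{- Let $B_k$ be the complete binary tree on $n=2^{k+1}-1$ vertices. For any Graphical House Allocation instance $(B_k,H)$ with $H=\{h_1\le\dots\le h_n\}$, let $v_1,\dots,v_n$ be the vertices of $B_k$ in the standard in-order traversal, and let $\pi$ be the allocation $\pi(v_j)=h_j$ for $1\le j\le n$. Then $\mathrm{Envy}(\pi,B_k)$ is at most $3.5$ times the minimum of $\mathrm{Envy}(\pi',B_k)$ over all allocations $\pi'$.
   Context: An instance of Graphical House Allocation is a pair $(G,H)$, where $G=(V,E)$ is an undirected simple graph on $n$ vertices and $H=\{h_1,\dots,h_n\}$ is a multiset of nonnegative real numbers. An allocation is a bijection $\pi:V\to H$ (counting multiplicity). Its envy is $\mathrm{Envy}(\pi,G)=\sum_{(i,j)\in E}|\pi(i)-\pi(j)|$. The complete binary tree $B_k$ is the rooted binary tree of depth $k$ with $2^{k+1}-1$ vertices, in which every internal node has a left and a right child and all $2^k$ leaves are at depth $k$. The in-order traversal recursively visits the left subtree, then the root, then the right subtree. -}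

module Defs where

open import Data.Fin.Base as Fin using (Fin; zero; suc; _↑ˡ_; _↑ʳ_)
open import Data.Fin.Properties using (splitAt⁻¹-↑ˡ; splitAt⁻¹-↑ʳ)
open import Data.List.Base as List using (List; []; _∷_; _++_)
open import Data.List.Relation.Unary.All as All using (All; []; _∷_)
import Data.List.Relation.Unary.All.Properties as All
open import Data.List.Relation.Unary.AllPairs as AllPairs using (AllPairs; []; _∷_)
import Data.List.Relation.Unary.AllPairs.Properties as AllPairs
open import Data.Nat.Base as ℕ using (ℕ; zero; suc)
import Data.Nat.Properties as ℕ
import Data.Nat.Tactic.RingSolver as ℕ-Solver
open import Data.Product.Base using (_×_; _,_; proj₁; proj₂; ∃; swap)
open import Data.Rational.Base as ℚ using (ℚ; 0ℚ; ½; Positive)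
import Data.Rational.Properties as ℚ
open import Data.Rational.Solver using (module +-*-Solver)
open import Data.Sum.Base using (inj₁; inj₂)
open import Data.Vec.Base as Vec using (Vec; []; _∷_)
import Data.Vec.Properties as Vec
open import Function.Base using (_∘_)
open import Function.Bundles using (_⤖_; mk⤖; module Bijection)
open import Relation.Binary.PropositionalEquality

-- The Cauchy completion of ℚ.  The choice of N in terms of ε is part of
-- the data.  Two reals x and y are equal when x ≤ y and y ≤ x, not when
-- their underlying sequences are.

IsCauchy : (ℕ → ℚ) → Set
IsCauchy s = ∀ ε → 0ℚ ℚ.< ε → ∃ λ N →
  ∀ m n → N ℕ.≤ m → N ℕ.≤ n → ℚ.∣ s m ℚ.- s n ∣ ℚ.≤ ε

record ℝ : Set where
  constructor mkℝ
  field
    seq    : ℕ → ℚ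
    cauchy : IsCauchy seq

open ℝ public

infix  4 _≤_
infixl 6 _+_ _-_
infixl 7 _·_

_≤_ : ℝ → ℝ → Set
x ≤ y = ∀ ε → 0ℚ ℚ.< ε → ∃ λ N → ∀ n → N ℕ.≤ n → seq x n ℚ.≤ seq y n ℚ.+ ε

private

  half-pos : ∀ ε → 0ℚ ℚ.< ε → 0ℚ ℚ.< ½ ℚ.* ε
  half-pos ε 0<ε =
    ℚ.positive⁻¹ _ {{ℚ.pos*pos⇒pos ½ ε {{ℚ.positive 0<ε}}}}

  half+half : ∀ ε → ½ ℚ.* ε ℚ.+ ½ ℚ.* ε ≡ ε
  half+half ε =
    trans (sym (ℚ.*-distribʳ-+ ε ½ ½)) (ℚ.*-identityˡ ε)

  ∣-∣-sub : ∀ a b → ℚ.∣ a ∣ ℚ.- ℚ.∣ b ∣ ℚ.≤ ℚ.∣ a ℚ.- b ∣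
  ∣-∣-sub a b = begin
    ℚ.∣ a ∣ ℚ.- ℚ.∣ b ∣
      ≡⟨ cong (λ t → ℚ.∣ t ∣ ℚ.- ℚ.∣ b ∣)
           (solve 2 (λ a b → a := (a :- b) :+ b) refl a b) ⟩
    ℚ.∣ (a ℚ.- b) ℚ.+ b ∣ ℚ.- ℚ.∣ b ∣
      ≤⟨ ℚ.+-monoˡ-≤ (ℚ.- ℚ.∣ b ∣) (ℚ.∣p+q∣≤∣p∣+∣q∣ (a ℚ.- b) b) ⟩
    (ℚ.∣ a ℚ.- b ∣ ℚ.+ ℚ.∣ b ∣) ℚ.- ℚ.∣ b ∣
      ≡⟨ solve 2 (λ s t → (s :+ t) :- t := s) refl ℚ.∣ a ℚ.- b ∣ ℚ.∣ b ∣ ⟩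
    ℚ.∣ a ℚ.- b ∣ ∎
    where
    open ℚ.≤-Reasoning
    open +-*-Solver

  ∣-∣-flip : ∀ a b → ℚ.∣ a ℚ.- b ∣ ≡ ℚ.∣ b ℚ.- a ∣
  ∣-∣-flip a b = trans (sym (ℚ.∣-p∣≡∣p∣ (a ℚ.- b)))
    (cong ℚ.∣_∣ (solve 2 (λ a b → :- (a :- b) := b :- a) refl a b))
    where open +-*-Solver

  ∣-∣-contracts : ∀ a b → ℚ.∣ ℚ.∣ a ∣ ℚ.- ℚ.∣ b ∣ ∣ ℚ.≤ ℚ.∣ a ℚ.- b ∣
  ∣-∣-contracts a b with ℚ.∣p∣≡p∨∣p∣≡-p (ℚ.∣ a ∣ ℚ.- ℚ.∣ b ∣)
  ... | inj₁ eq = subst (ℚ._≤ ℚ.∣ a ℚ.- b ∣) (sym eq) (∣-∣-sub a b)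
  ... | inj₂ eq = subst₂ ℚ._≤_
    (sym (trans eq (solve 2 (λ s t → :- (s :- t) := t :- s) refl ℚ.∣ a ∣ ℚ.∣ b ∣)))
    (∣-∣-flip b a) (∣-∣-sub b a)
    where open +-*-Solver

fromℚ : ℚ → ℝ
fromℚ q = mkℝ (λ _ → q) λ ε 0<ε → 0 , λ _ _ _ _ →
  subst (ℚ._≤ ε) (sym (cong ℚ.∣_∣ (ℚ.+-inverseʳ q))) (ℚ.<⇒≤ 0<ε)

0ℝ : ℝ
0ℝ = fromℚ 0ℚ

_+_ : ℝ → ℝ → ℝ
x + y = mkℝ (λ n → seq x n ℚ.+ seq y n) λ ε 0<ε →
  let (M , p) = cauchy x (½ ℚ.* ε) (half-pos ε 0<ε)
      (N , q) = cauchy y (½ ℚ.* ε) (half-pos ε 0<ε)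
  in M ℕ.⊔ N , λ m n m≥ n≥ → begin
    ℚ.∣ (seq x m ℚ.+ seq y m) ℚ.- (seq x n ℚ.+ seq y n) ∣
      ≡⟨ cong ℚ.∣_∣ (solve 4 (λ a b c d → (a :+ b) :- (c :+ d) := (a :- c) :+ (b :- d))
           refl (seq x m) (seq y m) (seq x n) (seq y n)) ⟩
    ℚ.∣ (seq x m ℚ.- seq x n) ℚ.+ (seq y m ℚ.- seq y n) ∣
      ≤⟨ ℚ.∣p+q∣≤∣p∣+∣q∣ (seq x m ℚ.- seq x n) (seq y m ℚ.- seq y n) ⟩
    ℚ.∣ seq x m ℚ.- seq x n ∣ ℚ.+ ℚ.∣ seq y m ℚ.- seq y n ∣
      ≤⟨ ℚ.+-mono-≤
           (p m n (ℕ.m⊔n≤o⇒m≤o M N m≥) (ℕ.m⊔n≤o⇒m≤o M N n≥))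
           (q m n (ℕ.m⊔n≤o⇒n≤o M N m≥) (ℕ.m⊔n≤o⇒n≤o M N n≥)) ⟩
    ½ ℚ.* ε ℚ.+ ½ ℚ.* ε
      ≡⟨ half+half ε ⟩
    ε ∎
  where
  open ℚ.≤-Reasoning
  open +-*-Solver

-_ : ℝ → ℝ
- x = mkℝ (λ n → ℚ.- seq x n) λ ε 0<ε →
  let (N , p) = cauchy x ε 0<ε
  in N , λ m n m≥ n≥ → subst (ℚ._≤ ε)
    (trans (∣-∣-flip (seq x m) (seq x n))
      (cong ℚ.∣_∣ (solve 2 (λ a b → b :- a := :- a :- :- b) refl (seq x m) (seq x n))))
    (p m n m≥ n≥)
  where open +-*-Solver

_-_ : ℝ → ℝ → ℝ
x - y = x + (- y)

∣_∣ : ℝ → ℝ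
∣ x ∣ = mkℝ (λ n → ℚ.∣ seq x n ∣) λ ε 0<ε →
  let (N , p) = cauchy x ε 0<ε
  in N , λ m n m≥ n≥ →
    ℚ.≤-trans (∣-∣-contracts (seq x m) (seq x n)) (p m n m≥ n≥)

_·_ : (q : ℚ) .{{_ : Positive q}} → ℝ → ℝ
q · x = mkℝ (λ n → q ℚ.* seq x n) λ ε 0<ε →
  let (N , p) = cauchy x (1/q ℚ.* ε)
                  (ℚ.positive⁻¹ _ {{ℚ.pos*pos⇒pos 1/q {{ℚ.1/pos⇒pos q}} ε {{ℚ.positive 0<ε}}}})
  in N , λ m n m≥ n≥ → begin
    ℚ.∣ q ℚ.* seq x m ℚ.- q ℚ.* seq x n ∣
      ≡⟨ cong ℚ.∣_∣ (solve 3 (λ q a b → q :* a :- q :* b := q :* (a :- b))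
           refl q (seq x m) (seq x n)) ⟩
    ℚ.∣ q ℚ.* (seq x m ℚ.- seq x n) ∣
      ≡⟨ ℚ.∣p*q∣≡∣p∣*∣q∣ q (seq x m ℚ.- seq x n) ⟩
    ℚ.∣ q ∣ ℚ.* ℚ.∣ seq x m ℚ.- seq x n ∣
      ≡⟨ cong (ℚ._* _) (ℚ.0≤p⇒∣p∣≡p (ℚ.<⇒≤ (ℚ.positive⁻¹ q))) ⟩
    q ℚ.* ℚ.∣ seq x m ℚ.- seq x n ∣
      ≤⟨ ℚ.*-monoˡ-≤-nonNeg q {{ℚ.pos⇒nonNeg q}} (p m n m≥ n≥) ⟩
    q ℚ.* (1/q ℚ.* ε)
      ≡⟨ ℚ.*-assoc q 1/q ε ⟨
    (q ℚ.* 1/q) ℚ.* ε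
      ≡⟨ cong (ℚ._* ε) (ℚ.*-inverseʳ q {{ℚ.pos⇒nonZero q}}) ⟩
    ℚ.1ℚ ℚ.* ε
      ≡⟨ ℚ.*-identityˡ ε ⟩
    ε ∎
  where
  open ℚ.≤-Reasoning
  open +-*-Solver
  1/q : ℚ
  1/q = ℚ.1/_ q {{ℚ.pos⇒nonZero q}}

sum : List ℝ → ℝ
sum = List.foldr _+_ 0ℝ

-- Each undirected edge is listed once, in one of its two orientations.

record SimpleGraph : Set₁ where
  field
    Vertex   : Set
    edges    : List (Vertex × Vertex)
    loopless : All (λ e → proj₁ e ≢ proj₂ e) edges
    simple   : AllPairs (λ e f → e ≢ f × e ≢ swap f) edges

open SimpleGraph public using (edges)

-- An allocation assigns to each vertex the index of a house.  Working with
-- indices rather than values counts houses of equal value with multiplicity.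

Allocation : SimpleGraph → ℕ → Set
Allocation G n = SimpleGraph.Vertex G ⤖ Fin n

Envy : ∀ {n} (G : SimpleGraph) (h : Fin n → ℝ) → Allocation G n → ℝ
Envy G h π = sum (List.map (λ (u , v) → ∣ h (to u) - h (to v) ∣) (edges G))
  where open Bijection π using (to)

-- A vertex is the path leading to it from the root.

data Vertex : ℕ → Set where
  root  : ∀ {k} → Vertex k
  left  : ∀ {k} → Vertex k → Vertex (suc k)
  right : ∀ {k} → Vertex k → Vertex (suc k)

leftEdge rightEdge : ∀ {k} → Vertex k × Vertex k → Vertex (suc k) × Vertex (suc k)
leftEdge  (u , v) = left u  , left v
rightEdge (u , v) = right u , right v

treeEdges : ∀ k → List (Vertex k × Vertex k)
treeEdges zero    = []
treeEdges (suc k) =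
  (root , left root) ∷ (root , right root) ∷
  List.map leftEdge (treeEdges k) ++
  List.map rightEdge (treeEdges k)

private

  left-injective : ∀ {k} {u v : Vertex k} → left u ≡ left v → u ≡ v
  left-injective refl = refl

  right-injective : ∀ {k} {u v : Vertex k} → right u ≡ right v → u ≡ v
  right-injective refl = refl

  treeEdges-loopless : ∀ k → All (λ e → proj₁ e ≢ proj₂ e) (treeEdges k)
  treeEdges-loopless zero    = []
  treeEdges-loopless (suc k) = (λ ()) ∷ (λ ()) ∷ All.++⁺
    (All.map⁺ (All.map (λ ne → ne ∘ left-injective) (treeEdges-loopless k)))
    (All.map⁺ (All.map (λ ne → ne ∘ right-injective) (treeEdges-loopless k)))

  treeEdges-simple : ∀ k → AllPairs (λ e f → e ≢ f × e ≢ swap f) (treeEdges k)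
  treeEdges-simple zero    = []
  treeEdges-simple (suc k) =
    (((λ ()) , (λ ())) ∷ root-apart) ∷ root-apart ∷
    AllPairs.++⁺
      (AllPairs.map⁺ (AllPairs.map
        (λ (p , q) → (λ { refl → p refl }) , (λ { refl → q refl }))
        (treeEdges-simple k)))
      (AllPairs.map⁺ (AllPairs.map
        (λ (p , q) → (λ { refl → p refl }) , (λ { refl → q refl }))
        (treeEdges-simple k)))
      (All.map⁺ (All.universal (λ _ →
        All.map⁺ (All.universal (λ _ → (λ ()) , (λ ())) (treeEdges k))) (treeEdges k)))
    where
    root-apart : ∀ {v} → All (λ f → (root , v) ≢ f × (root , v) ≢ swap f)
      (List.map leftEdge (treeEdges k) ++ List.map rightEdge (treeEdges k))
    root-apart = All.++⁺
      (All.map⁺ (All.universal (λ _ → (λ ()) , (λ ())) (treeEdges k)))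
      (All.map⁺ (All.universal (λ _ → (λ ()) , (λ ())) (treeEdges k)))

B : ℕ → SimpleGraph
B k = record
  { Vertex   = Vertex k
  ; edges    = treeEdges k
  ; loopless = treeEdges-loopless k
  ; simple   = treeEdges-simple k
  }

size : ℕ → ℕ
size zero    = 1
size (suc k) = size k ℕ.+ suc (size k)

size≡2^[1+k]∸1 : ∀ k → size k ≡ 2 ℕ.^ suc k ℕ.∸ 1
size≡2^[1+k]∸1 k = sym (cong (ℕ._∸ 1) (2^≡1+size k))
  where
  2^≡1+size : ∀ k → 2 ℕ.^ suc k ≡ suc (size k)
  2^≡1+size zero    = refl
  2^≡1+size (suc k) = trans (cong (2 ℕ.*_) (2^≡1+size k)) (lemma (size k))
    where
    lemma : ∀ s → 2 ℕ.* suc s ≡ suc (s ℕ.+ suc s)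
    lemma = ℕ-Solver.solve-∀

inorder : ∀ k → Vec (Vertex k) (size k)
inorder zero    = root ∷ []
inorder (suc k) =
  Vec.map left (inorder k) Vec.++ root ∷ Vec.map right (inorder k)

-- The index of a vertex in inorder k, by lookup-position and
-- position-lookup below.

position : ∀ {k} → Vertex k → Fin (size k)
position {zero}  root      = zero
position {suc k} root      = size k ↑ʳ zero
position {suc k} (left v)  = position v ↑ˡ suc (size k)
position {suc k} (right v) = size k ↑ʳ suc (position v)

lookup-position : ∀ {k} (v : Vertex k) → Vec.lookup (inorder k) (position v) ≡ v
lookup-position {zero}  root = refl
lookup-position {suc k} root =
  Vec.lookup-++ʳ (Vec.map left (inorder k)) _ zero
lookup-position {suc k} (left v) =
  trans (Vec.lookup-++ˡ (Vec.map left (inorder k)) _ (position v))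
  (trans (Vec.lookup-map (position v) left (inorder k))
    (cong left (lookup-position v)))
lookup-position {suc k} (right v) =
  trans (Vec.lookup-++ʳ (Vec.map left (inorder k)) _ (suc (position v)))
  (trans (Vec.lookup-map (position v) right (inorder k))
    (cong right (lookup-position v)))

position-lookup : ∀ k (j : Fin (size k)) → position (Vec.lookup (inorder k) j) ≡ j
position-lookup zero    zero = refl
position-lookup (suc k) j with Fin.splitAt (size k) j in eq
... | inj₁ i
  rewrite sym (splitAt⁻¹-↑ˡ eq)
        | Vec.lookup-++ˡ (Vec.map left (inorder k)) (root ∷ Vec.map right (inorder k)) i
        | Vec.lookup-map i left (inorder k)
  = cong (_↑ˡ suc (size k)) (position-lookup k i)
... | inj₂ zero
  rewrite sym (splitAt⁻¹-↑ʳ {size k} eq)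
        | Vec.lookup-++ʳ (Vec.map left (inorder k)) (root ∷ Vec.map right (inorder k)) zero
  = refl
... | inj₂ (suc i)
  rewrite sym (splitAt⁻¹-↑ʳ {size k} eq)
        | Vec.lookup-++ʳ (Vec.map left (inorder k)) (root ∷ Vec.map right (inorder k)) (suc i)
        | Vec.lookup-map i right (inorder k)
  = cong (λ t → size k ↑ʳ suc t) (position-lookup k i)

inorderAllocation : ∀ k → Allocation (B k) (size k)
inorderAllocation k = mk⤖
  ( (λ {u} {v} eq → trans (sym (lookup-position u))
      (trans (cong (Vec.lookup (inorder k)) eq) (lookup-position v)))
  , (λ j → Vec.lookup (inorder k) j , λ { refl → position-lookup k j })
  )

{-# OPTIONS --safe #-}

-- The envy of an allocation is the sum, over the gaps between consecutive
-- sorted values, of the gap times the number of edges separating the cheapest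
-- c houses from the others, so it suffices to compare these cuts for each c.
-- For the in-order allocation the cut is the number of changes between
-- adjacent bits of c.  For a set S of c vertices, c is a signed sum, over the
-- cut edges, of numbers 2 ^ j - 1 (the sizes of the subtrees hanging off those
-- edges), starting from 0 or from 2 ^ (1 + k) - 1 according to whether S
-- contains the root; neither start has a bit change.  Adding a power of two
-- alters at most two bit changes and adding 1 at most one, so c has at most
-- three bit changes per cut edge.  This gives the factor 3, which is below 7/2.

module Submission where

module Cuts where

  open import Defs
    using ( Vertex; root; left; right; leftEdge; rightEdge; treeEdges; size
          ; inorder; position; B; Allocation; inorderAllocation )
  open import Data.Bool.Base using (Bool; true; false; not; _xor_)
  open import Data.Bool.Properties using (not-involutive; xor-comm; xor-identityʳ)
  open import Data.Fin.Base using (Fin; zero; suc; toℕ)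
  open import Data.Fin.Properties using (toℕ<n; toℕ-↑ˡ; toℕ-↑ʳ)
  open import Data.List.Base as List using (List; []; _∷_; _++_)
  open import Data.List.Properties using (map-++; map-∘; map-cong)
  open import Data.Nat.Base
  open import Data.Nat.ListAction using (sum)
  open import Data.Nat.ListAction.Properties using (sum-++)
  open import Data.Nat.Properties
  open import Data.Nat.Solver using (module +-*-Solver)
  open import Data.Product.Base using (_×_; _,_)
  open import Data.Sum.Base using (inj₁; inj₂)
  open import Data.Vec.Base as Vec using (Vec; []; _∷_)
  import Data.Vec.Properties as Vec
  open import Function.Base using (_∘_; const)
  open import Function.Bundles using (module Bijection)
  open import Function.Construct.Composition using (_↔-∘_)
  open import Function.Construct.Symmetry using (↔-sym)
  open import Function.Properties.Bijection using (⤖⇒↔)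
  open import Relation.Binary.PropositionalEquality
  open import Algebra.Properties.CommutativeMonoid.Sum +-0-commutativeMonoid
    using () renaming (sum to ∑; sum-permute to ∑-permute)

  -- Changes between adjacent binary digits, and how addition affects them.

  ⟦_⟧ : Bool → ℕ
  ⟦ true ⟧  = 1
  ⟦ false ⟧ = 0

  ∣⟦⟧-⟦⟧∣≤1 : ∀ a b → ∣ ⟦ a ⟧ - ⟦ b ⟧ ∣ ≤ 1
  ∣⟦⟧-⟦⟧∣≤1 true  true  = z≤n
  ∣⟦⟧-⟦⟧∣≤1 true  false = ≤-refl
  ∣⟦⟧-⟦⟧∣≤1 false true  = ≤-refl
  ∣⟦⟧-⟦⟧∣≤1 false false = z≤n

  ∣-∣-+ : ∀ a b c d → ∣ a + b - c + d ∣ ≤ ∣ a - c ∣ + ∣ b - d ∣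
  ∣-∣-+ a b c d = begin
    ∣ a + b - c + d ∣                        ≤⟨ ∣-∣-triangle (a + b) (c + b) (c + d) ⟩
    ∣ a + b - c + b ∣ + ∣ c + b - c + d ∣
      ≡⟨ cong₂ _+_ (trans (cong₂ ∣_-_∣ (+-comm a b) (+-comm c b)) (∣m+n-m+o∣≡∣n-o∣ b a c))
                   (∣m+n-m+o∣≡∣n-o∣ c b d) ⟩
    ∣ a - c ∣ + ∣ b - d ∣ ∎
    where open ≤-Reasoning

  odd : ℕ → Bool
  odd zero    = false
  odd (suc n) = not (odd n)

  -- Counts the i < n for which bits i and i + 1 of x differ. Only bits 0 to n are read, so for n =
  -- k and x up to `size k` bit k is never compared with the zero above it.
  changes : ℕ → ℕ → ℕ
  changes zero    x = 0
  changes (suc n) x = ⟦ odd x xor odd ⌊ x /2⌋ ⟧ + changes n ⌊ x /2⌋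

  bit : ℕ → ℕ → Bool
  bit zero    x = odd x
  bit (suc n) x = bit n ⌊ x /2⌋

  -- The recursion in `changes` starts at the low end, whereas induction on the height of the tree
  -- removes the top bit; this exposes the topmost pair.
  changes-suc : ∀ n x → changes (suc n) x ≡ changes n x + ⟦ bit n x xor bit (suc n) x ⟧
  changes-suc zero    x = +-identityʳ _
  changes-suc (suc n) x =
    trans (cong (⟦ odd x xor odd ⌊ x /2⌋ ⟧ +_) (changes-suc n ⌊ x /2⌋))
          (sym (+-assoc ⟦ odd x xor odd ⌊ x /2⌋ ⟧ _ _))

  odd-2a+x : ∀ a x → odd (a + a + x) ≡ odd x
  odd-2a+x zero    x = refl
  odd-2a+x (suc a) x rewrite +-suc a a | odd-2a+x a x = not-involutive (odd x)

  ⌊2a+x/2⌋ : ∀ a x → ⌊ a + a + x /2⌋ ≡ a + ⌊ x /2⌋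
  ⌊2a+x/2⌋ zero    x = refl
  ⌊2a+x/2⌋ (suc a) x rewrite +-suc a a = cong suc (⌊2a+x/2⌋ a x)

  -- Powers of two are written suc (size k) = 2 ^ (1 + k), since suc (size (suc k))
  -- reduces to suc (size k) + suc (size k).

  odd-pow+ : ∀ k x → odd (suc (size k) + x) ≡ odd x
  odd-pow+ zero    x = odd-2a+x 1 x
  odd-pow+ (suc k) x = odd-2a+x (suc (size k)) x

  -- `suc (size k)` is 2 ^ (1 + k), so the addition leaves bits 0 to k alone, and for n ≤ k no other
  -- bit is read.
  changes-pow+ : ∀ {n k} → n ≤ k → ∀ x → changes n (suc (size k) + x) ≡ changes n x
  changes-pow+ z≤n x = refl
  changes-pow+ {suc n} {suc k} (s≤s n≤k) x
    rewrite odd-2a+x (suc (size k)) x | ⌊2a+x/2⌋ (suc (size k)) x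
          | odd-pow+ k ⌊ x /2⌋ | changes-pow+ n≤k ⌊ x /2⌋ = refl

  bit-pow+ : ∀ {n k} → n ≤ k → ∀ x → bit n (suc (size k) + x) ≡ bit n x
  bit-pow+ {k = k} z≤n x = odd-pow+ k x
  bit-pow+ {suc n} {suc k} (s≤s n≤k) x
    rewrite ⌊2a+x/2⌋ (suc (size k)) x = bit-pow+ n≤k ⌊ x /2⌋

  ⌊≤size/2⌋ : ∀ k {x} → x ≤ size (suc k) → ⌊ x /2⌋ ≤ size k
  ⌊≤size/2⌋ k {x} x≤ = begin
    ⌊ x /2⌋                     ≤⟨ ⌊n/2⌋-mono x≤ ⟩
    ⌊ size k + suc (size k) /2⌋ ≡⟨ cong ⌊_/2⌋ (trans (+-suc _ _) (+-comm 1 _)) ⟩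
    ⌊ size k + size k + 1 /2⌋   ≡⟨ ⌊2a+x/2⌋ (size k) 1 ⟩
    size k + 0                  ≡⟨ +-identityʳ _ ⟩
    size k                      ∎
    where open ≤-Reasoning

  bit-small : ∀ k {x} → x ≤ size k → bit (suc k) x ≡ false
  bit-small zero    {0}           _         = refl
  bit-small zero    {1}           _         = refl
  bit-small zero    {suc (suc _)} (s≤s ())
  bit-small (suc k) {x}           x≤        = bit-small k (⌊≤size/2⌋ k x≤)

  bit-pow+small : ∀ k {x} → x ≤ size k → bit (suc k) (suc (size k) + x) ≡ true
  bit-pow+small zero {0}           _ = refl
  bit-pow+small zero {1}           _ = refl
  bit-pow+small zero {suc (suc _)} (s≤s ())
  bit-pow+small (suc k) {x} x≤
    rewrite ⌊2a+x/2⌋ (suc (size k)) x = bit-pow+small k (⌊≤size/2⌋ k x≤)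

  changes-0 : ∀ n → changes n 0 ≡ 0
  changes-0 zero    = refl
  changes-0 (suc n) = changes-0 n

  data Half : ℕ → Set where
    double   : ∀ y → Half (y + y)
    1+double : ∀ y → Half (suc (y + y))

  half : ∀ x → Half x
  half zero    = double 0
  half (suc x) with half x
  ... | double y   = 1+double y
  ... | 1+double y = subst Half (cong suc (+-suc y y)) (double (suc y))

  odd-2a : ∀ a → odd (a + a) ≡ false
  odd-2a a = trans (cong odd (sym (+-identityʳ (a + a)))) (odd-2a+x a 0)

  ⌊2a/2⌋ : ∀ a → ⌊ a + a /2⌋ ≡ a
  ⌊2a/2⌋ a = sym (n≡⌊n+n/2⌋ a)

  ⌊1+2a/2⌋ : ∀ a → ⌊ suc (a + a) /2⌋ ≡ a
  ⌊1+2a/2⌋ a = trans (cong ⌊_/2⌋ (+-comm 1 (a + a))) (trans (⌊2a+x/2⌋ a 1) (+-identityʳ a))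

  odd-size : ∀ n → odd (size n) ≡ true
  odd-size zero    = refl
  odd-size (suc n) rewrite +-suc (size n) (size n) | odd-2a (size n) = refl

  -- The bits 0 to n of 2 ^ (1 + n) - 1 are all 1.
  changes-size : ∀ n → changes n (size n) ≡ 0
  changes-size zero    = refl
  changes-size (suc n)
    rewrite +-suc (size n) (size n) | odd-2a (size n) | ⌊1+2a/2⌋ (size n) | odd-size n
    = changes-size n

  -- On an even number only the lowest bit flips, which affects one pair. On an odd one the carry
  -- takes the lowest pair from (1, b) to (0, not b), so its contribution stays the same and the
  -- difference passes to the remaining bits.
  changes-+1 : ∀ n x → ∣ changes n x - changes n (suc x) ∣ ≤ 1
  changes-+1 zero    x = z≤n
  changes-+1 (suc n) x with half x
  ... | double y rewrite odd-2a y | ⌊1+2a/2⌋ y | ⌊2a/2⌋ y = begin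
    ∣ ⟦ odd y ⟧ + changes n y - ⟦ not (odd y) ⟧ + changes n y ∣
      ≤⟨ ∣-∣-+ ⟦ odd y ⟧ _ ⟦ not (odd y) ⟧ _ ⟩
    ∣ ⟦ odd y ⟧ - ⟦ not (odd y) ⟧ ∣ + ∣ changes n y - changes n y ∣
      ≤⟨ +-mono-≤ (∣⟦⟧-⟦⟧∣≤1 (odd y) _) (≤-reflexive (m≡n⇒∣m-n∣≡0 {changes n y} refl)) ⟩
    1 ∎
    where open ≤-Reasoning
  ... | 1+double y rewrite odd-2a y | ⌊1+2a/2⌋ y | ⌊2a/2⌋ y
    | ∣m+n-m+o∣≡∣n-o∣ ⟦ not (odd y) ⟧ (changes n y) (changes n (suc y)) = changes-+1 n y

  -- The bits below position 1 + k are untouched, and the number formed by the others is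
  -- incremented. The increment costs at most 1 by `changes-+1`, and the pair at positions k and 1 +
  -- k at most 1 more.
  changes-+pow : ∀ n k x → ∣ changes n x - changes n (suc (size k) + x) ∣ ≤ 2
  changes-+pow zero    k    x = z≤n
  changes-+pow (suc n) zero x rewrite odd-2a+x 1 x = begin
    ∣ ⟦ odd x xor odd y ⟧ + changes n y - ⟦ odd x xor not (odd y) ⟧ + changes n (suc y) ∣
      ≤⟨ ∣-∣-+ ⟦ odd x xor odd y ⟧ _ ⟦ odd x xor not (odd y) ⟧ _ ⟩
    ∣ ⟦ odd x xor odd y ⟧ - ⟦ odd x xor not (odd y) ⟧ ∣ + ∣ changes n y - changes n (suc y) ∣
      ≤⟨ +-mono-≤ (∣⟦⟧-⟦⟧∣≤1 (odd x xor odd y) _) (changes-+1 n y) ⟩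
    2 ∎
    where
    open ≤-Reasoning
    y = ⌊ x /2⌋
  changes-+pow (suc n) (suc k) x
    rewrite odd-2a+x (suc (size k)) x | ⌊2a+x/2⌋ (suc (size k)) x | odd-pow+ k ⌊ x /2⌋
    | ∣m+n-m+o∣≡∣n-o∣ ⟦ odd x xor odd ⌊ x /2⌋ ⟧
        (changes n ⌊ x /2⌋) (changes n (suc (size k) + ⌊ x /2⌋))
    = changes-+pow n k ⌊ x /2⌋

  -- Adding 2 ^ (1 + k) - 1 means adding the power and taking 1 away, at a cost of 2 + 1.
  changes-+size : ∀ n k x → ∣ changes n x - changes n (size k + x) ∣ ≤ 3
  changes-+size n k x = begin
    ∣ changes n x - changes n (size k + x) ∣
      ≤⟨ ∣-∣-triangle (changes n x) (changes n (suc (size k) + x)) (changes n (size k + x)) ⟩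
    ∣ changes n x - changes n (suc (size k) + x) ∣ +
      ∣ changes n (suc (size k) + x) - changes n (size k + x) ∣
      ≤⟨ +-mono-≤ (changes-+pow n k x)
          (≤-trans (≤-reflexive (∣-∣-comm (changes n (suc (size k) + x)) _))
                   (changes-+1 n (size k + x))) ⟩
    3 ∎
    where open ≤-Reasoning

  -- Edge cuts, and their values for the in-order allocation.

  cut : {V : Set} → (V → Bool) → List (V × V) → ℕ
  cut S E = sum (List.map (λ (u , v) → ⟦ S u xor S v ⟧) E)

  cut-cong : ∀ {V : Set} {S T : V → Bool} → S ≗ T → cut S ≗ cut T
  cut-cong S≗T E = cong sum
    (map-cong (λ (u , v) → cong₂ (λ a b → ⟦ a xor b ⟧) (S≗T u) (S≗T v)) E)

  cut-const : ∀ {V : Set} b (E : List (V × V)) → cut (const b) E ≡ 0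
  cut-const b     []      = refl
  cut-const true  (_ ∷ E) = cut-const true E
  cut-const false (_ ∷ E) = cut-const false E

  cut-treeEdges : ∀ k (S : Vertex (suc k) → Bool) → cut S (treeEdges (suc k)) ≡
    ⟦ S root xor S (left root) ⟧ + (⟦ S root xor S (right root) ⟧ +
      (cut (S ∘ left) (treeEdges k) + cut (S ∘ right) (treeEdges k)))
  cut-treeEdges k S = cong (λ c → ⟦ S root xor S (left root) ⟧ + (⟦ S root xor S (right root) ⟧ + c))
    (begin
      sum (List.map f (List.map leftEdge E ++ List.map rightEdge E))
        ≡⟨ cong sum (map-++ f (List.map leftEdge E) _) ⟩
      sum (List.map f (List.map leftEdge E) ++ List.map f (List.map rightEdge E))
        ≡⟨ sum-++ (List.map f (List.map leftEdge E)) _ ⟩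
      sum (List.map f (List.map leftEdge E)) + sum (List.map f (List.map rightEdge E))
        ≡⟨ cong₂ (λ xs ys → sum xs + sum ys) (map-∘ E) (map-∘ E) ⟨
      cut (S ∘ left) E + cut (S ∘ right) E ∎)
    where
    open ≡-Reasoning
    E = treeEdges k
    f : Vertex (suc k) × Vertex (suc k) → ℕ
    f (u , v) = ⟦ S u xor S v ⟧

  <ᵇ-true : ∀ {m n} → m < n → (m <ᵇ n) ≡ true
  <ᵇ-true {zero}  (s≤s _)   = refl
  <ᵇ-true {suc m} (s≤s m<n) = <ᵇ-true m<n

  <ᵇ-false : ∀ {m n} → n ≤ m → (m <ᵇ n) ≡ false
  <ᵇ-false {m}     z≤n       = refl
  <ᵇ-false {suc m} (s≤s n≤m) = <ᵇ-false n≤m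

  +-cancelˡ-<ᵇ : ∀ k m n → (k + m <ᵇ k + n) ≡ (m <ᵇ n)
  +-cancelˡ-<ᵇ zero    m n = refl
  +-cancelˡ-<ᵇ (suc k) m n = +-cancelˡ-<ᵇ k m n

  below : ∀ {n} → ℕ → Fin n → Bool
  below c j = toℕ j <ᵇ c

  -- A view by the top bit. The initial positions either lie within the left subtree, or fill the
  -- left subtree and the root; in `inRight`, c is what is left over for the right subtree.
  data Split (k : ℕ) : ℕ → Set where
    inLeft  : ∀ {c} → c ≤ size k → Split k c
    inRight : ∀ {c} → c ≤ size k → Split k (suc (size k) + c)

  split : ∀ k {c} → c ≤ size (suc k) → Split k c
  split k {c} c≤ with ≤-<-connex c (size k)
  ... | inj₁ c≤s = inLeft c≤s
  ... | inj₂ s<c with c ∸ suc (size k) | m+[n∸m]≡n s<c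
  ...   | d | refl = inRight (+-cancelˡ-≤ (suc (size k)) d (size k)
          (≤-trans c≤ (≤-reflexive (+-suc (size k) (size k)))))

  left-all : ∀ {k c} → size k ≤ c → (v : Vertex k) → below c (position (left v)) ≡ true
  left-all {k} s≤c v rewrite toℕ-↑ˡ (position v) (suc (size k)) =
    <ᵇ-true (<-≤-trans (toℕ<n (position v)) s≤c)

  right-none : ∀ {k c} → c ≤ suc (size k) → (v : Vertex k) → below c (position (right v)) ≡ false
  right-none {k} c≤ v rewrite toℕ-↑ʳ (size k) (suc (position v)) | +-suc (size k) (toℕ (position v)) =
    <ᵇ-false (≤-trans c≤ (m≤m+n _ _))

  left-same : ∀ {k} c (v : Vertex k) → below c (position (left v)) ≡ below c (position v)
  left-same {k} c v rewrite toℕ-↑ˡ (position v) (suc (size k)) = refl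

  right-same : ∀ {k} c (v : Vertex k) →
    below (suc (size k) + c) (position (right v)) ≡ below c (position v)
  right-same {k} c v rewrite toℕ-↑ʳ (size k) (suc (position v)) | +-suc (size k) (toℕ (position v)) =
    +-cancelˡ-<ᵇ (size k) _ c

  root-none : ∀ {k c} → c ≤ size k → below c (position {suc k} root) ≡ false
  root-none {k} c≤ rewrite toℕ-↑ʳ (size k) (zero {size k}) = <ᵇ-false (≤-trans c≤ (m≤m+n _ _))

  root-all : ∀ {k c} → below (suc (size k) + c) (position {suc k} root) ≡ true
  root-all {k} {c} rewrite toℕ-↑ʳ (size k) (zero {size k}) | +-identityʳ (size k) =
    <ᵇ-true (s≤s (m≤m+n (size k) c))

  -- The root of a tree of height k has position 2 ^ k - 1, so it is among the first c vertices
  -- exactly when c ≥ 2 ^ k, that is, when the top bit of c is set.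
  below-root : ∀ k {c} → c ≤ size k → below c (position {k} root) ≡ bit k c
  below-root zero    {0}           _        = refl
  below-root zero    {1}           _        = refl
  below-root zero    {suc (suc _)} (s≤s ())
  below-root (suc k) c≤ with split k c≤
  ... | inLeft c≤s  = trans (root-none {k} c≤s) (sym (bit-small k c≤s))
  ... | inRight c≤s = trans (root-all {k}) (sym (bit-pow+small k c≤s))

  -- One of the two subtrees agrees entirely with the root, so nothing is cut in it or on its edge
  -- to the root. The other edge at the root is cut exactly when the two top bits differ, by
  -- `below-root`; the other subtree falls under the induction hypothesis.
  cut-inorder : ∀ k {c} → c ≤ size k → cut (below c ∘ position) (treeEdges k) ≡ changes k c
  cut-inorder zero    _  = refl
  cut-inorder (suc k) c≤ with split k c≤
  ... | inLeft {c} c≤s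
    rewrite cut-treeEdges k (below c ∘ position) | changes-suc k c
          | root-none {k} c≤s | left-same {k} c root | right-none {k} (m≤n⇒m≤1+n c≤s) root
          | bit-small k c≤s | below-root k c≤s
          | cut-cong (left-same {k} c) (treeEdges k)
          | cut-cong (right-none {k} (m≤n⇒m≤1+n c≤s)) (treeEdges k)
          | cut-const false (treeEdges k)
          | cut-inorder k c≤s
          | xor-identityʳ (bit k c)
    = trans (cong (⟦ bit k c ⟧ +_) (+-identityʳ _)) (+-comm _ (changes k c))
  ... | inRight {c} c≤s
    rewrite cut-treeEdges k (below (suc (size k) + c) ∘ position)
          | changes-suc k (suc (size k) + c)
          | root-all {k} {c} | left-all {k} (m≤n⇒m≤1+n (m≤m+n (size k) c)) root | right-same {k} c root
          | bit-pow+small k c≤s | below-root k c≤s | bit-pow+ (≤-refl {k}) c | changes-pow+ (≤-refl {k}) c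
          | cut-cong (left-all {k} (m≤n⇒m≤1+n (m≤m+n (size k) c))) (treeEdges k)
          | cut-cong (right-same {k} c) (treeEdges k)
          | cut-const true (treeEdges k)
          | cut-inorder k c≤s
          | xor-comm (bit k c) true
    = +-comm ⟦ not (bit k c) ⟧ _

  -- Sizes of vertex sets, and the bound on their bit changes by the cut.

  card : ∀ {k} → (Vertex k → Bool) → ℕ
  card {zero}  S = ⟦ S root ⟧
  card {suc k} S = card (S ∘ left) + (⟦ S root ⟧ + card (S ∘ right))

  card≡sum : ∀ k (S : Vertex k → Bool) → card S ≡ Vec.sum (Vec.map (⟦_⟧ ∘ S) (inorder k))
  card≡sum zero    S = sym (+-identityʳ _)
  card≡sum (suc k) S = sym (begin
    Vec.sum (Vec.map f (Vec.map left I Vec.++ root ∷ Vec.map right I))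
      ≡⟨ cong Vec.sum (Vec.map-++ f (Vec.map left I) _) ⟩
    Vec.sum (Vec.map f (Vec.map left I) Vec.++ f root ∷ Vec.map f (Vec.map right I))
      ≡⟨ Vec.sum-++ (Vec.map f (Vec.map left I)) ⟩
    Vec.sum (Vec.map f (Vec.map left I)) + (f root + Vec.sum (Vec.map f (Vec.map right I)))
      ≡⟨ cong₂ (λ xs ys → Vec.sum xs + (f root + Vec.sum ys)) (Vec.map-∘ f left I) (Vec.map-∘ f right I) ⟨
    Vec.sum (Vec.map (f ∘ left) I) + (f root + Vec.sum (Vec.map (f ∘ right) I))
      ≡⟨ cong₂ (λ a b → a + (f root + b)) (card≡sum k (S ∘ left)) (card≡sum k (S ∘ right)) ⟨
    card S ∎)
    where
    open ≡-Reasoning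
    I = inorder k
    f = ⟦_⟧ ∘ S

  sum-map≡∑ : ∀ {A : Set} {n} (f : A → ℕ) (xs : Vec A n) →
    Vec.sum (Vec.map f xs) ≡ ∑ (f ∘ Vec.lookup xs)
  sum-map≡∑ f []       = refl
  sum-map≡∑ f (x ∷ xs) = cong (f x +_) (sum-map≡∑ f xs)

  ∑-below : ∀ n {c} → c ≤ n → ∑ {n} (⟦_⟧ ∘ below c) ≡ c
  ∑-below zero    z≤n       = refl
  ∑-below (suc n) z≤n       = ∑-below n z≤n
  ∑-below (suc n) (s≤s c≤n) = cong suc (∑-below n c≤n)

  -- Listing the vertices in order turns the size into a sum over `Fin (size k)`, and π after the
  -- inverse of the in-order allocation is a permutation of that index set.
  card-below : ∀ {k c} → c ≤ size k → (π : Allocation (B k) (size k)) →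
    card (below c ∘ Bijection.to π) ≡ c
  card-below {k} {c} c≤ π = begin
    card (below c ∘ to)                            ≡⟨ card≡sum k _ ⟩
    Vec.sum (Vec.map (⟦_⟧ ∘ below c ∘ to) (inorder k)) ≡⟨ sum-map≡∑ _ (inorder k) ⟩
    ∑ (⟦_⟧ ∘ below c ∘ to ∘ Vec.lookup (inorder k))
      ≡⟨ ∑-permute {size k} (⟦_⟧ ∘ below c) (⤖⇒↔ π ↔-∘ ↔-sym (⤖⇒↔ (inorderAllocation k))) ⟨
    ∑ {size k} (⟦_⟧ ∘ below c)                     ≡⟨ ∑-below (size k) c≤ ⟩
    c ∎
    where
    open ≡-Reasoning
    open Bijection π using (to)

  -- Here y = x + (|S| - r * size k), and |S| - r * size k is the sum of
  -- ± size j over the edges cut by S, where j is the height of the lower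
  -- endpoint.  The bound on x keeps all intermediate values nonnegative.
  changes-tree : ∀ n k (S : Vertex k → Bool) {r} → S root ≡ r → ∀ x y →
    y + ⟦ r ⟧ * size k ≡ x + card S → 2 * size k ≤ x →
    changes n y ≤ changes n x + 3 * cut S (treeEdges k)

  -- Treats the edge from a parent with membership r to the root of a subtree. If the ends agree,
  -- `changes-tree` applies from the same start. Otherwise the start shifts by `size k`, up or down,
  -- which costs at most 3 by `changes-+size`.
  changes-branch : ∀ n k (S : Vertex k → Bool) r x y →
    y + ⟦ r ⟧ * size k ≡ x + card S → 3 * size k ≤ x →
    changes n y ≤ changes n x + 3 * (⟦ r xor S root ⟧ + cut S (treeEdges k))

  changes-tree n zero S refl x y eq _ =
    ≤-trans (≤-reflexive (cong (changes n) (+-cancelʳ-≡ ⟦ S root ⟧ y x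
              (trans (cong (y +_) (sym (*-identityʳ _))) eq))))
            (m≤m+n _ _)
  changes-tree n (suc k) S {r} refl x y eq 2s≤x = begin
    changes n y
      ≤⟨ changes-branch n k (S ∘ right) r z y eqʳ 3s≤z ⟩
    changes n z + 3 * (⟦ r xor S (right root) ⟧ + cutʳ)
      ≤⟨ +-monoˡ-≤ _ (changes-branch n k (S ∘ left) r x z eqˡ 3s≤x) ⟩
    changes n x + 3 * (⟦ r xor S (left root) ⟧ + cutˡ) + 3 * (⟦ r xor S (right root) ⟧ + cutʳ)
      ≡⟨ solve 5 (λ d a b c e →
           d :+ con 3 :* (a :+ b) :+ con 3 :* (c :+ e) := d :+ con 3 :* (a :+ (c :+ (b :+ e))))
         refl (changes n x) ⟦ r xor S (left root) ⟧ cutˡ ⟦ r xor S (right root) ⟧ cutʳ ⟩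
    changes n x + 3 * (⟦ r xor S (left root) ⟧ + (⟦ r xor S (right root) ⟧ + (cutˡ + cutʳ)))
      ≡⟨ cong (λ c → changes n x + 3 * c) (cut-treeEdges k S) ⟨
    changes n x + 3 * cut S (treeEdges (suc k)) ∎
    where
    open ≤-Reasoning
    open +-*-Solver using (solve; _:=_; _:+_; _:*_; con)
    s = size k
    cˡ = card (S ∘ left)
    cʳ = card (S ∘ right)
    cutˡ = cut (S ∘ left) (treeEdges k)
    cutʳ = cut (S ∘ right) (treeEdges k)
    -- The value reached after the left branch, from which the right branch starts. By `eqˡ` the
    -- subtraction is exact.
    z = x + cˡ ∸ ⟦ r ⟧ * s

    ⟦r⟧s≤s : ∀ r → ⟦ r ⟧ * s ≤ s
    ⟦r⟧s≤s true  = ≤-reflexive (*-identityˡ s)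
    ⟦r⟧s≤s false = z≤n

    -- `2 * size (suc k)` is 4 * s + 2. The left branch lowers the value by at most s, which leaves
    -- the 3 * s that the right branch requires.
    4s≤x : 3 * s + s ≤ x
    4s≤x = begin
      3 * s + s       ≤⟨ m≤m+n _ 2 ⟩
      3 * s + s + 2   ≡⟨ solve 1 (λ s → con 3 :* s :+ s :+ con 2 := con 2 :* (s :+ (con 1 :+ s))) refl s ⟩
      2 * (s + suc s) ≤⟨ 2s≤x ⟩
      x               ∎

    3s≤x : 3 * s ≤ x
    3s≤x = ≤-trans (m≤m+n _ s) 4s≤x

    eqˡ : z + ⟦ r ⟧ * s ≡ x + cˡ
    eqˡ = m∸n+n≡m (≤-trans (⟦r⟧s≤s r) (≤-trans (m≤n+m s (3 * s)) (≤-trans 4s≤x (m≤m+n x cˡ))))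

    3s≤z : 3 * s ≤ z
    3s≤z = +-cancelʳ-≤ (⟦ r ⟧ * s) _ _ (begin
      3 * s + ⟦ r ⟧ * s ≤⟨ +-monoʳ-≤ (3 * s) (⟦r⟧s≤s r) ⟩
      3 * s + s         ≤⟨ 4s≤x ⟩
      x                 ≤⟨ m≤m+n x cˡ ⟩
      x + cˡ            ≡⟨ eqˡ ⟨
      z + ⟦ r ⟧ * s     ∎)

    eqʳ : y + ⟦ r ⟧ * s ≡ z + cʳ
    eqʳ = +-cancelʳ-≡ (⟦ r ⟧ * s + ⟦ r ⟧) _ _ (begin-equality
      y + ⟦ r ⟧ * s + (⟦ r ⟧ * s + ⟦ r ⟧)
        ≡⟨ solve 3 (λ y r s → y :+ r :* s :+ (r :* s :+ r) := y :+ r :* (s :+ (con 1 :+ s)))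
             refl y ⟦ r ⟧ s ⟩
      y + ⟦ r ⟧ * (s + suc s)
        ≡⟨ eq ⟩
      x + (cˡ + (⟦ r ⟧ + cʳ))
        ≡⟨ +-assoc x cˡ _ ⟨
      x + cˡ + (⟦ r ⟧ + cʳ)
        ≡⟨ cong (_+ (⟦ r ⟧ + cʳ)) eqˡ ⟨
      z + ⟦ r ⟧ * s + (⟦ r ⟧ + cʳ)
        ≡⟨ solve 4 (λ z r s c → z :+ r :* s :+ (r :+ c) := z :+ c :+ (r :* s :+ r))
             refl z ⟦ r ⟧ s cʳ ⟩
      z + cʳ + (⟦ r ⟧ * s + ⟦ r ⟧) ∎)

  changes-branch n k S r x y eq 3s≤x with S root in e
  changes-branch n k S true  x y eq 3s≤x | true  =
    changes-tree n k S e x y eq (≤-trans (m≤n+m _ (size k)) 3s≤x)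
  changes-branch n k S false x y eq 3s≤x | false =
    changes-tree n k S e x y eq (≤-trans (m≤n+m _ (size k)) 3s≤x)
  -- Here y is x + `card S`; starting from `size k + x` gives the form that `changes-tree` requires
  -- when the root is in S.
  changes-branch n k S false x y eq 3s≤x | true  = begin
    changes n y
      ≤⟨ changes-tree n k S e (size k + x) y
          (trans (solve 2 (λ y s → y :+ con 1 :* s := s :+ (y :+ con 0)) refl y (size k))
            (trans (cong (size k +_) eq) (sym (+-assoc (size k) x _))))
          (≤-trans (m≤n+m _ (size k)) (≤-trans 3s≤x (m≤n+m x (size k)))) ⟩
    changes n (size k + x) + 3 * c
      ≤⟨ +-monoˡ-≤ (3 * c) (m≤n+∣m-n∣ (changes n (size k + x)) (changes n x)) ⟩
    changes n x + ∣ changes n (size k + x) - changes n x ∣ + 3 * c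
      ≤⟨ +-monoˡ-≤ (3 * c) (+-monoʳ-≤ (changes n x)
          (≤-trans (≤-reflexive (∣-∣-comm (changes n (size k + x)) _)) (changes-+size n k x))) ⟩
    changes n x + 3 + 3 * c
      ≡⟨ solve 2 (λ d c → d :+ con 3 :+ con 3 :* c := d :+ con 3 :* (con 1 :+ c)) refl (changes n x) c ⟩
    changes n x + 3 * (1 + c) ∎
    where
    open ≤-Reasoning
    open +-*-Solver using (solve; _:=_; _:+_; _:*_; con)
    c = cut S (treeEdges k)
  -- Conversely, the term `size k` next to y is absorbed by starting from x - `size k`, which is
  -- still at least 2 * `size k`.
  changes-branch n k S true  x y eq 3s≤x | false = begin
    changes n y
      ≤⟨ changes-tree n k S e x′ y
          (+-cancelʳ-≡ (size k) _ _ (trans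
            (solve 2 (λ y s → y :+ con 0 :+ s := y :+ con 1 :* s) refl y (size k))
            (trans eq (trans (cong (_+ card S) (sym x′+s≡x))
              (solve 3 (λ x s c → x :+ s :+ c := x :+ c :+ s) refl x′ (size k) (card S))))))
          2s≤x′ ⟩
    changes n x′ + 3 * c
      ≤⟨ +-monoˡ-≤ (3 * c) (m≤n+∣m-n∣ (changes n x′) (changes n (size k + x′))) ⟩
    changes n (size k + x′) + ∣ changes n x′ - changes n (size k + x′) ∣ + 3 * c
      ≤⟨ +-monoˡ-≤ (3 * c) (+-monoʳ-≤ (changes n (size k + x′)) (changes-+size n k x′)) ⟩
    changes n (size k + x′) + 3 + 3 * c
      ≡⟨ cong (λ t → changes n t + 3 + 3 * c) (trans (+-comm (size k) x′) x′+s≡x) ⟩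
    changes n x + 3 + 3 * c
      ≡⟨ solve 2 (λ d c → d :+ con 3 :+ con 3 :* c := d :+ con 3 :* (con 1 :+ c)) refl (changes n x) c ⟩
    changes n x + 3 * (1 + c) ∎
    where
    open ≤-Reasoning
    open +-*-Solver using (solve; _:=_; _:+_; _:*_; con)
    c = cut S (treeEdges k)
    x′ = x ∸ size k

    x′+s≡x : x′ + size k ≡ x
    x′+s≡x = m∸n+n≡m (≤-trans (m≤m+n (size k) _) 3s≤x)

    2s≤x′ : 2 * size k ≤ x′
    2s≤x′ = +-cancelʳ-≤ (size k) _ _ (begin
      2 * size k + size k ≡⟨ +-comm (2 * size k) _ ⟩
      3 * size k          ≤⟨ 3s≤x ⟩
      x                   ≡⟨ x′+s≡x ⟨
      x′ + size k         ∎)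

  -- The start is 0 or `size k`, neither of which has a bit change. Adding 2 ^ (1 + k) twice
  -- provides the room demanded by `changes-tree` and is invisible to `changes k`.
  changes-card : ∀ k (S : Vertex k → Bool) → changes k (card S) ≤ 3 * cut S (treeEdges k)
  changes-card k S = begin
    changes k (card S)                     ≡⟨ trans (period (p + card S)) (period (card S)) ⟨
    changes k (p + (p + card S))           ≤⟨ changes-tree k k S refl (p + (p + ⟦ S root ⟧ * size k)) _
        (solve 3 (λ p c r → p :+ (p :+ c) :+ r := p :+ (p :+ r) :+ c) refl p (card S) _) 2s≤x ⟩
    changes k (p + (p + ⟦ S root ⟧ * size k)) + 3 * cut S (treeEdges k)
      ≡⟨ cong (_+ 3 * cut S (treeEdges k))
          (trans (period (p + ⟦ S root ⟧ * size k))
          (trans (period (⟦ S root ⟧ * size k)) (changes-start (S root)))) ⟩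
    3 * cut S (treeEdges k) ∎
    where
    open ≤-Reasoning
    open +-*-Solver using (solve; _:=_; _:+_; _:*_; con)
    p = suc (size k)

    period : ∀ x → changes k (p + x) ≡ changes k x
    period = changes-pow+ (≤-refl {k})

    changes-start : ∀ r → changes k (⟦ r ⟧ * size k) ≡ 0
    changes-start true  = trans (cong (changes k) (*-identityˡ (size k))) (changes-size k)
    changes-start false = changes-0 k

    2s≤x : 2 * size k ≤ p + (p + ⟦ S root ⟧ * size k)
    2s≤x = +-mono-≤ (n≤1+n _) (+-mono-≤ (n≤1+n _) z≤n)

  -- Every allocation puts the c cheapest houses on exactly c vertices, so `changes k c` links the
  -- two cuts.
  cut-inorder-optimal : ∀ k {c} → c ≤ size k → (π : Allocation (B k) (size k)) →
    cut (below c ∘ position) (treeEdges k) ≤ 3 * cut (below c ∘ Bijection.to π) (treeEdges k)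
  cut-inorder-optimal k {c} c≤ π = begin
    cut (below c ∘ position) (treeEdges k)              ≡⟨ cut-inorder k c≤ ⟩
    changes k c                                         ≡⟨ cong (changes k) (card-below c≤ π) ⟨
    changes k (card (below c ∘ Bijection.to π))         ≤⟨ changes-card k _ ⟩
    3 * cut (below c ∘ Bijection.to π) (treeEdges k)    ∎
    where open ≤-Reasoning

-- Decomposition of envy into layers, one for each gap between consecutive values.

import Data.Nat.Properties as ℕ
open Cuts using (⟦_⟧; cut; below; cut-inorder-optimal)
open import Algebra.Bundles using (AbelianGroup)
open import Data.Bool.Base using (_xor_)
open import Data.Bool.Properties using (xor-comm)
open import Data.Fin.Base as Fin using (Fin; zero; suc; toℕ; inject₁)
open import Data.Fin.Properties using (toℕ<n; toℕ-inject₁)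
open import Data.List.Base as List using (List; []; _∷_)
open import Data.Nat.Base as ℕ using (ℕ; zero; suc; z≤n; s≤s)
open import Data.Product.Base using (_×_; _,_)
open import Function.Base using (_∘_)
open import Level using (0ℓ)
open import Relation.Binary.Bundles using (Preorder)
open import Relation.Binary.Core using (Rel)
open import Relation.Binary.PropositionalEquality using (_≡_; _≗_; refl; sym; trans; cong; cong₂)
open import Relation.Binary.Structures using (IsPreorder)

-- The layer decomposition is carried out in an abstract group because
-- comparing terms of ℝ directly unfolds their proofs of the Cauchy property.
record MetricGroup : Set₁ where
  infix 4 _≤_
  field
    abelianGroup : AbelianGroup 0ℓ 0ℓ
  open AbelianGroup abelianGroup public
    renaming ( _∙_ to _+_; ε to 0#; _⁻¹ to -_; refl to ≈-refl; sym to ≈-sym; trans to ≈-trans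
             ; ∙-cong to +-cong; ∙-congˡ to +-congˡ; ∙-congʳ to +-congʳ; assoc to +-assoc; comm to +-comm
             ; identityˡ to +-identityˡ; identityʳ to +-identityʳ; inverseʳ to +-inverseʳ )
  field
    _≤_           : Rel Carrier 0ℓ
    ≤-isPreorder  : IsPreorder _≈_ _≤_
    +-mono-≤      : ∀ {x y u v} → x ≤ y → u ≤ v → x + u ≤ y + v
    dist          : Carrier → Carrier → Carrier
    dist-refl     : ∀ x → dist x x ≈ 0#
    dist-comm     : ∀ x y → dist x y ≈ dist y x
    dist-triangle : ∀ x y z → dist x z ≤ dist x y + dist y z
    0≤dist        : ∀ x y → 0# ≤ dist x y
    x-y≤dist      : ∀ x y → x - y ≤ dist x y

  ≤-preorder : Preorder 0ℓ 0ℓ 0ℓ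
  ≤-preorder = record { isPreorder = ≤-isPreorder }

  open IsPreorder ≤-isPreorder public using ()
    renaming (refl to ≤-refl; reflexive to ≤-reflexive; trans to ≤-trans)

module Layers (G : MetricGroup) where

  open MetricGroup G
  open import Algebra.Properties.AbelianGroup abelianGroup using (//-rightDividesˡ)
  open import Algebra.Properties.CommutativeMonoid.Sum commutativeMonoid
    using (sum-replicate-zero; sum-cong-≋; sum-cong-≗; ∑-distrib-+) renaming (sum to ∑)
  open import Algebra.Properties.Monoid.Mult monoid
    using (×-homo-+) renaming (_×_ to _×ᵣ_)
  open import Relation.Binary.Reasoning.Preorder ≤-preorder

  x-y+y-z≈x-z : ∀ x y z → (x - y) + (y - z) ≈ x - z
  x-y+y-z≈x-z x y z = ≈-trans (≈-sym (+-assoc (x - y) y (- z))) (+-congʳ (//-rightDividesˡ y x))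

  0≤×ᵣ : ∀ n {x} → 0# ≤ x → 0# ≤ n ×ᵣ x
  0≤×ᵣ zero    0≤x = ≤-refl
  0≤×ᵣ (suc n) {x} 0≤x = begin
    0#            ≈⟨ +-identityˡ 0# ⟨
    0# + 0#       ≲⟨ +-mono-≤ 0≤x (0≤×ᵣ n 0≤x) ⟩
    x + n ×ᵣ x    ∎

  ×ᵣ-mono-≤ : ∀ {m n x y} → m ℕ.≤ n → x ≤ y → 0# ≤ y → m ×ᵣ x ≤ n ×ᵣ y
  ×ᵣ-mono-≤ {n = n} z≤n       x≤y 0≤y = 0≤×ᵣ n 0≤y
  ×ᵣ-mono-≤         (s≤s m≤n) x≤y 0≤y = +-mono-≤ x≤y (×ᵣ-mono-≤ m≤n x≤y 0≤y)

  ×ᵣ-monoʳ-≤ : ∀ n {x y} → x ≤ y → n ×ᵣ x ≤ n ×ᵣ y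
  ×ᵣ-monoʳ-≤ zero    x≤y = ≤-refl
  ×ᵣ-monoʳ-≤ (suc n) x≤y = +-mono-≤ x≤y (×ᵣ-monoʳ-≤ n x≤y)

  layers : ∀ {n} → (Fin n → ℕ) → (Fin n → Carrier) → Carrier
  layers w z = ∑ λ i → w i ×ᵣ z i

  layers-0 : ∀ {n} (z : Fin n → Carrier) → layers (λ _ → 0) z ≈ 0#
  layers-0 {n} z = sum-replicate-zero n

  layers-+ : ∀ {n} (w w′ : Fin n → ℕ) (z : Fin n → Carrier) →
    layers (λ i → w i ℕ.+ w′ i) z ≈ layers w z + layers w′ z
  layers-+ w w′ z = ≈-trans
    (sum-cong-≋ λ i → ×-homo-+ (z i) (w i) (w′ i))
    (∑-distrib-+ (λ i → w i ×ᵣ z i) (λ i → w′ i ×ᵣ z i))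

  layers-* : ∀ {n} m (w : Fin n → ℕ) (z : Fin n → Carrier) →
    layers (λ i → m ℕ.* w i) z ≈ m ×ᵣ layers w z
  layers-* zero    w z = layers-0 z
  layers-* (suc m) w z = ≈-trans (layers-+ w (λ i → m ℕ.* w i) z) (+-congˡ (layers-* m w z))

  layers-mono-≤ : ∀ {n} {w w′ : Fin n → ℕ} {z z′ : Fin n → Carrier} →
    (∀ i → w i ℕ.≤ w′ i) → (∀ i → z i ≤ z′ i) → (∀ i → 0# ≤ z′ i) → layers w z ≤ layers w′ z′
  layers-mono-≤ {zero}  _    _    _    = ≤-refl
  layers-mono-≤ {suc n} w≤w′ z≤z′ 0≤z′ =
    +-mono-≤ (×ᵣ-mono-≤ (w≤w′ zero) (z≤z′ zero) (0≤z′ zero))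
             (layers-mono-≤ (w≤w′ ∘ suc) (z≤z′ ∘ suc) (0≤z′ ∘ suc))

  -- The signed `gap` telescopes and serves for lower bounds on distances; the unsigned `step`
  -- serves for upper bounds by the triangle inequality. Sortedness enters only in comparing the
  -- two.
  gap : ∀ {n} → (Fin (suc n) → Carrier) → Fin n → Carrier
  gap h i = h (suc i) - h (inject₁ i)

  step : ∀ {n} → (Fin (suc n) → Carrier) → Fin n → Carrier
  step h i = dist (h (suc i)) (h (inject₁ i))

  -- Gap i lies between houses i and i + 1, so the houses below it are those with index less than
  -- `suc (toℕ i)`.
  separates : ∀ {n} → Fin (suc n) → Fin (suc n) → Fin n → ℕ
  separates u v i = ⟦ below (suc (toℕ i)) u xor below (suc (toℕ i)) v ⟧

  layers-separates-comm : ∀ {n} (u v : Fin (suc n)) (z : Fin n → Carrier) →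
    layers (separates u v) z ≡ layers (separates v u) z
  layers-separates-comm u v z = sum-cong-≗ λ i → cong (λ b → ⟦ b ⟧ ×ᵣ z i)
    (xor-comm (below (suc (toℕ i)) u) (below (suc (toℕ i)) v))

  -- The triangle inequality along the chain of houses from u to v. Gap 0 does not separate two
  -- nonzero indices, so the induction drops house 0.
  dist≤layers : ∀ {n} (h : Fin (suc n) → Carrier) u v →
    dist (h u) (h v) ≤ layers (separates u v) (step h)
  dist₀≤layers : ∀ {n} (h : Fin (suc (suc n)) → Carrier) v →
    dist (h zero) (h (suc v)) ≤ layers (separates zero (suc v)) (step h)

  dist≤layers h zero zero = begin
    dist (h zero) (h zero)    ≈⟨ dist-refl (h zero) ⟩
    0#                        ≈⟨ layers-0 (step h) ⟨
    layers (λ _ → 0) (step h) ∎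
  dist≤layers {suc n} h zero (suc v) = dist₀≤layers h v
  dist≤layers {suc n} h (suc u) zero = begin
    dist (h (suc u)) (h zero)                ≈⟨ dist-comm (h (suc u)) (h zero) ⟩
    dist (h zero) (h (suc u))                ≲⟨ dist₀≤layers h u ⟩
    layers (separates zero (suc u)) (step h) ≡⟨ layers-separates-comm zero (suc u) (step h) ⟩
    layers (separates (suc u) zero) (step h) ∎
  dist≤layers {suc n} h (suc u) (suc v) = begin
    dist (h (suc u)) (h (suc v))                  ≲⟨ dist≤layers (h ∘ suc) u v ⟩
    layers (separates u v) (step (h ∘ suc))       ≈⟨ +-identityˡ _ ⟨
    0# + layers (separates u v) (step (h ∘ suc))  ∎

  dist₀≤layers h v = begin
    dist (h zero) (h (suc v))
      ≲⟨ dist-triangle (h zero) (h (suc zero)) (h (suc v)) ⟩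
    dist (h zero) (h (suc zero)) + dist (h (suc zero)) (h (suc v))
      ≈⟨ +-congʳ (≈-trans (dist-comm (h zero) (h (suc zero))) (≈-sym (+-identityʳ _))) ⟩
    -- `step h zero + 0#` is the layer of gap 0, which has weight 1 because it separates `zero` from
    -- `suc v`.
    step h zero + 0# + dist (h (suc zero)) (h (suc v))
      ≲⟨ +-mono-≤ ≤-refl (dist≤layers (h ∘ suc) zero v) ⟩
    layers (separates zero (suc v)) (step h) ∎

  -- The gaps separating v from house 0 are those before v, and their sum telescopes.
  layers≈h-h₀ : ∀ {n} (h : Fin (suc n) → Carrier) v →
    layers (separates zero v) (gap h) ≈ h v - h zero
  layers≈h-h₀ h zero = ≈-trans (layers-0 (gap h)) (≈-sym (+-inverseʳ (h zero)))
  layers≈h-h₀ {suc n} h (suc v) =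
    ≈-trans (+-cong (+-identityʳ (gap h zero)) (layers≈h-h₀ (h ∘ suc) v))
    (≈-trans (+-comm _ _) (x-y+y-z≈x-z (h (suc v)) (h (suc zero)) (h zero)))

  layers≤dist : ∀ {n} (h : Fin (suc n) → Carrier) u v →
    layers (separates u v) (gap h) ≤ dist (h u) (h v)
  layers≤dist h zero v = begin
    layers (separates zero v) (gap h) ≈⟨ layers≈h-h₀ h v ⟩
    h v - h zero                      ≲⟨ x-y≤dist (h v) (h zero) ⟩
    dist (h v) (h zero)               ≈⟨ dist-comm (h v) (h zero) ⟩
    dist (h zero) (h v)               ∎
  layers≤dist {suc n} h (suc u) zero = begin
    layers (separates (suc u) zero) (gap h) ≡⟨ layers-separates-comm (suc u) zero (gap h) ⟩
    layers (separates zero (suc u)) (gap h) ≈⟨ layers≈h-h₀ h (suc u) ⟩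
    h (suc u) - h zero                      ≲⟨ x-y≤dist (h (suc u)) (h zero) ⟩
    dist (h (suc u)) (h zero)               ∎
  layers≤dist {suc n} h (suc u) (suc v) = begin
    0# + layers (separates u v) (gap (h ∘ suc)) ≈⟨ +-identityˡ _ ⟩
    layers (separates u v) (gap (h ∘ suc))      ≲⟨ layers≤dist (h ∘ suc) u v ⟩
    dist (h (suc u)) (h (suc v))                ∎

  module _ {V : Set} where

    envy : ∀ {N} → (Fin N → Carrier) → (V → Fin N) → List (V × V) → Carrier
    envy h f E = List.foldr _+_ 0# (List.map (λ (u , v) → dist (h (f u)) (h (f v))) E)

    cuts : ∀ {n} → (V → Fin (suc n)) → List (V × V) → Fin n → ℕ
    cuts f E i = cut (below (suc (toℕ i)) ∘ f) E

    -- Exchanging the sums over edges and gaps collects, as the weight of a gap, the number of edges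
    -- that it cuts.
    envy≤layers : ∀ {n} (h : Fin (suc n) → Carrier) f E →
      envy h f E ≤ layers (cuts f E) (step h)
    envy≤layers h f [] = ≤-reflexive (≈-sym (layers-0 (step h)))
    envy≤layers h f ((u , v) ∷ E) = begin
      dist (h (f u)) (h (f v)) + envy h f E
        ≲⟨ +-mono-≤ (dist≤layers h (f u) (f v)) (envy≤layers h f E) ⟩
      layers (separates (f u) (f v)) (step h) + layers (cuts f E) (step h)
        ≈⟨ layers-+ (separates (f u) (f v)) (cuts f E) (step h) ⟨
      layers (cuts f ((u , v) ∷ E)) (step h) ∎

    layers≤envy : ∀ {n} (h : Fin (suc n) → Carrier) f E →
      layers (cuts f E) (gap h) ≤ envy h f E
    layers≤envy h f [] = ≤-reflexive (layers-0 (gap h))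
    layers≤envy h f ((u , v) ∷ E) = begin
      layers (cuts f ((u , v) ∷ E)) (gap h)
        ≈⟨ layers-+ (separates (f u) (f v)) (cuts f E) (gap h) ⟩
      layers (separates (f u) (f v)) (gap h) + layers (cuts f E) (gap h)
        ≲⟨ +-mono-≤ (layers≤dist h (f u) (f v)) (layers≤envy h f E) ⟩
      dist (h (f u)) (h (f v)) + envy h f E ∎

    -- Compares the two envies layer by layer, replacing steps by gaps and cuts of f by m times cuts
    -- of f′. Sortedness is phrased through `dist`, the form in which it bounds steps by gaps.
    envy-mono : ∀ {N} m (h : Fin N → Carrier) (f f′ : V → Fin N) E →
      (∀ i j → i Fin.≤ j → dist (h j) (h i) ≤ h j - h i) →
      (∀ {c} → c ℕ.≤ N → cut (below c ∘ f) E ℕ.≤ m ℕ.* cut (below c ∘ f′) E) →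
      envy h f E ≤ m ×ᵣ envy h f′ E
    envy-mono m h f f′ [] _ _ = 0≤×ᵣ m ≤-refl
    -- An edge supplies a vertex and hence a house, so N has the form `suc n` needed for gaps.
    envy-mono {zero} m h f f′ ((u , _) ∷ _) _ _ with () ← f u
    envy-mono {suc n} m h f f′ E@(_ ∷ _) sorted cut≤ = begin
      envy h f E                                ≲⟨ envy≤layers h f E ⟩
      layers (cuts f E) (step h)
        ≲⟨ layers-mono-≤ (λ i → cut≤ (ℕ.m≤n⇒m≤1+n (toℕ<n i))) step≤gap
             (λ i → ≤-trans (0≤dist (h (suc i)) (h (inject₁ i))) (step≤gap i)) ⟩
      layers (λ i → m ℕ.* cuts f′ E i) (gap h)  ≈⟨ layers-* m (cuts f′ E) (gap h) ⟩
      m ×ᵣ layers (cuts f′ E) (gap h)           ≲⟨ ×ᵣ-monoʳ-≤ m (layers≤envy h f′ E) ⟩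
      m ×ᵣ envy h f′ E                          ∎
      where
      step≤gap : ∀ i → step h i ≤ gap h i
      step≤gap i = sorted (inject₁ i) (suc i)
        (ℕ.≤-trans (ℕ.≤-reflexive (toℕ-inject₁ i)) (ℕ.n≤1+n (toℕ i)))

-- The reals as an instance of the abstract metric group.

open import Defs
open import Algebra.Bundles using (RawGroup)
import Algebra.Construct.Pointwise as Pointwise
import Data.Integer.Base as ℤ
import Data.Rational.Properties as ℚ
open import Algebra.Morphism.Structures using (IsGroupMonomorphism)
open import Algebra.Morphism.GroupMonomorphism using (isAbelianGroup)
open import Data.Integer.Base using (+_)
open import Data.Rational.Base as ℚ using (ℚ; 0ℚ; ½; _/_)
open import Data.Rational.Solver using (module +-*-Solver)
open import Data.Sum.Base using (inj₁; inj₂)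
open import Function.Bundles using (module Bijection)

½-pos : ∀ {ε} → 0ℚ ℚ.< ε → 0ℚ ℚ.< ½ ℚ.* ε
½-pos {ε} 0<ε = ℚ.positive⁻¹ _ {{ℚ.pos*pos⇒pos ½ ε {{ℚ.positive 0<ε}}}}

½+½ : ∀ ε → ½ ℚ.* ε ℚ.+ ½ ℚ.* ε ≡ ε
½+½ ε = trans (sym (ℚ.*-distribʳ-+ ε ½ ½)) (ℚ.*-identityˡ ε)

p≤p+ε : ∀ p {ε} → 0ℚ ℚ.< ε → p ℚ.≤ p ℚ.+ ε
p≤p+ε p {ε} 0<ε = begin
  p          ≡⟨ ℚ.+-identityʳ p ⟨
  p ℚ.+ 0ℚ   ≤⟨ ℚ.+-monoʳ-≤ p (ℚ.<⇒≤ 0<ε) ⟩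
  p ℚ.+ ε    ∎
  where open ℚ.≤-Reasoning

p≤∣p∣ : ∀ p → p ℚ.≤ ℚ.∣ p ∣
p≤∣p∣ p with ℚ.≤-total 0ℚ p
... | inj₁ 0≤p = ℚ.≤-reflexive (sym (ℚ.0≤p⇒∣p∣≡p 0≤p))
... | inj₂ p≤0 = ℚ.≤-trans p≤0 (ℚ.0≤∣p∣ p)

∣p-q∣≡∣q-p∣ : ∀ p q → ℚ.∣ p ℚ.- q ∣ ≡ ℚ.∣ q ℚ.- p ∣
∣p-q∣≡∣q-p∣ p q = trans (sym (ℚ.∣-p∣≡∣p∣ (p ℚ.- q)))
  (cong ℚ.∣_∣ (solve 2 (λ p q → :- (p :- q) := q :- p) refl p q))
  where open +-*-Solver using (solve; _:=_; _:-_; :-_)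

∣p-r∣≤∣p-q∣+∣q-r∣ : ∀ p q r → ℚ.∣ p ℚ.- r ∣ ℚ.≤ ℚ.∣ p ℚ.- q ∣ ℚ.+ ℚ.∣ q ℚ.- r ∣
∣p-r∣≤∣p-q∣+∣q-r∣ p q r = begin
  ℚ.∣ p ℚ.- r ∣
    ≡⟨ cong ℚ.∣_∣ (solve 3 (λ p q r → p :- r := (p :- q) :+ (q :- r)) refl p q r) ⟩
  ℚ.∣ (p ℚ.- q) ℚ.+ (q ℚ.- r) ∣
    ≤⟨ ℚ.∣p+q∣≤∣p∣+∣q∣ (p ℚ.- q) (q ℚ.- r) ⟩
  ℚ.∣ p ℚ.- q ∣ ℚ.+ ℚ.∣ q ℚ.- r ∣ ∎
  where
  open ℚ.≤-Reasoning
  open +-*-Solver using (solve; _:=_; _:+_; _:-_)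

pointwise-≤ : ∀ x y → (∀ m → seq x m ℚ.≤ seq y m) → x ≤ y
pointwise-≤ x y p ε 0<ε = 0 , λ m _ → ℚ.≤-trans (p m) (p≤p+ε (seq y m) 0<ε)

≤ᴿ-trans : ∀ x y z → x ≤ y → y ≤ z → x ≤ z
≤ᴿ-trans x y z p q ε 0<ε with p (½ ℚ.* ε) (½-pos 0<ε) | q (½ ℚ.* ε) (½-pos 0<ε)
... | M , p′ | N , q′ = M ℕ.⊔ N , λ m m≥ → begin
  seq x m
    ≤⟨ p′ m (ℕ.m⊔n≤o⇒m≤o M N m≥) ⟩
  seq y m ℚ.+ ½ ℚ.* ε
    ≤⟨ ℚ.+-monoˡ-≤ (½ ℚ.* ε) (q′ m (ℕ.m⊔n≤o⇒n≤o M N m≥)) ⟩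
  seq z m ℚ.+ ½ ℚ.* ε ℚ.+ ½ ℚ.* ε
    ≡⟨ trans (ℚ.+-assoc (seq z m) _ _) (cong (seq z m ℚ.+_) (½+½ ε)) ⟩
  seq z m ℚ.+ ε ∎
  where open ℚ.≤-Reasoning

+ᴿ-mono-≤ : ∀ x y u v → x ≤ y → u ≤ v → x + u ≤ y + v
+ᴿ-mono-≤ x y u v p q ε 0<ε with p (½ ℚ.* ε) (½-pos 0<ε) | q (½ ℚ.* ε) (½-pos 0<ε)
... | M , p′ | N , q′ = M ℕ.⊔ N , λ m m≥ → begin
  seq x m ℚ.+ seq u m
    ≤⟨ ℚ.+-mono-≤ (p′ m (ℕ.m⊔n≤o⇒m≤o M N m≥)) (q′ m (ℕ.m⊔n≤o⇒n≤o M N m≥)) ⟩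
  (seq y m ℚ.+ ½ ℚ.* ε) ℚ.+ (seq v m ℚ.+ ½ ℚ.* ε)
    ≡⟨ solve 3 (λ y v e → (y :+ e) :+ (v :+ e) := (y :+ v) :+ (e :+ e)) refl
         (seq y m) (seq v m) (½ ℚ.* ε) ⟩
  (seq y m ℚ.+ seq v m) ℚ.+ (½ ℚ.* ε ℚ.+ ½ ℚ.* ε)
    ≡⟨ cong (seq y m ℚ.+ seq v m ℚ.+_) (½+½ ε) ⟩
  seq y m ℚ.+ seq v m ℚ.+ ε ∎
  where
  open ℚ.≤-Reasoning
  open +-*-Solver using (solve; _:=_; _:+_)

0≤seq-∣∣ : ∀ x m → 0ℚ ℚ.≤ seq ∣ x ∣ m
0≤seq-∣∣ x m = ℚ.0≤∣p∣ (seq x m)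

x≤∣x∣ : ∀ x → x ≤ ∣ x ∣
x≤∣x∣ x = pointwise-≤ x ∣ x ∣ λ m → p≤∣p∣ (seq x m)

∣-∣-triangle : ∀ x y z → ∣ x - z ∣ ≤ ∣ x - y ∣ + ∣ y - z ∣
∣-∣-triangle x y z = pointwise-≤ ∣ x - z ∣ (∣ x - y ∣ + ∣ y - z ∣)
  λ m → ∣p-r∣≤∣p-q∣+∣q-r∣ (seq x m) (seq y m) (seq z m)

-- For late terms a of x and b of y, only a ≤ b + ε/2 is known, so b - a may be negative. Its
-- absolute value is then (b - a) + 2 (a - b), which is at most (b - a) + ε.
x≤y⇒∣y-x∣≤y-x : ∀ x y → x ≤ y → ∣ y - x ∣ ≤ y + (- x)
x≤y⇒∣y-x∣≤y-x x y x≤y ε 0<ε with x≤y (½ ℚ.* ε) (½-pos 0<ε)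
... | N , x≤y+½ε = N , bound
  where
  open ℚ.≤-Reasoning
  open +-*-Solver using (solve; _:=_; _:+_; _:-_; :-_)
  bound : ∀ m → N ℕ.≤ m → ℚ.∣ seq y m ℚ.- seq x m ∣ ℚ.≤ (seq y m ℚ.- seq x m) ℚ.+ ε
  bound m m≥ with ℚ.∣p∣≡p∨∣p∣≡-p (seq y m ℚ.- seq x m)
  ... | inj₁ eq = ℚ.≤-trans (ℚ.≤-reflexive eq) (p≤p+ε (seq y m ℚ.- seq x m) 0<ε)
  ... | inj₂ eq = begin
    ℚ.∣ b ℚ.- a ∣
      ≡⟨ eq ⟩
    ℚ.- (b ℚ.- a)
      ≡⟨ solve 2 (λ a b → :- (b :- a) := (a :+ a) :+ (:- a :- b)) refl a b ⟩
    (a ℚ.+ a) ℚ.+ (ℚ.- a ℚ.- b)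
      ≤⟨ ℚ.+-monoˡ-≤ (ℚ.- a ℚ.- b) (ℚ.+-mono-≤ (x≤y+½ε m m≥) (x≤y+½ε m m≥)) ⟩
    ((b ℚ.+ ½ ℚ.* ε) ℚ.+ (b ℚ.+ ½ ℚ.* ε)) ℚ.+ (ℚ.- a ℚ.- b)
      ≡⟨ solve 3 (λ a b e → ((b :+ e) :+ (b :+ e)) :+ (:- a :- b) := (b :- a) :+ (e :+ e))
           refl a b (½ ℚ.* ε) ⟩
    (b ℚ.- a) ℚ.+ (½ ℚ.* ε ℚ.+ ½ ℚ.* ε)
      ≡⟨ cong (b ℚ.- a ℚ.+_) (½+½ ε) ⟩
    (b ℚ.- a) ℚ.+ ε ∎
    where
    a = seq x m
    b = seq y m

-- Equality of the underlying sequences is finer than equality of reals, but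
-- the group laws already hold for it.
ℝ-rawGroup : RawGroup 0ℓ 0ℓ
ℝ-rawGroup = record
  { _≈_ = λ x y → seq x ≗ seq y
  ; _∙_ = _+_
  ; ε   = 0ℝ
  ; _⁻¹ = -_
  }

-- Transfers the group laws from sequences of rationals under pointwise addition.
seq-isGroupMonomorphism : IsGroupMonomorphism ℝ-rawGroup
  (AbelianGroup.rawGroup (Pointwise.abelianGroup ℕ ℚ.+-0-abelianGroup)) seq
seq-isGroupMonomorphism = record
  { isGroupHomomorphism = record
    { isMonoidHomomorphism = record
      { isMagmaHomomorphism = record
        { isRelHomomorphism = record { cong = λ p → p }
        ; homo = λ _ _ _ → refl
        }
      ; ε-homo = λ _ → refl
      }
    ; ⁻¹-homo = λ _ _ → refl
    }
  ; injective = λ p → p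
  }

ℝ-abelianGroup : AbelianGroup 0ℓ 0ℓ
ℝ-abelianGroup = record
  { isAbelianGroup = isAbelianGroup seq-isGroupMonomorphism
      (Pointwise.isAbelianGroup ℕ ℚ.+-0-isAbelianGroup)
  }

open import Algebra.Properties.Monoid.Mult (AbelianGroup.monoid ℝ-abelianGroup)
  using () renaming (_×_ to _×ᵣ_)

≤-isPreorder : IsPreorder (AbelianGroup._≈_ ℝ-abelianGroup) _≤_
≤-isPreorder = record
  { isEquivalence = AbelianGroup.isEquivalence ℝ-abelianGroup
  ; reflexive     = λ {x} {y} p → pointwise-≤ x y λ m → ℚ.≤-reflexive (p m)
  ; trans         = λ {x} {y} {z} → ≤ᴿ-trans x y z
  }

ℝ-metricGroup : MetricGroup
ℝ-metricGroup = record
  { abelianGroup = ℝ-abelianGroup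
  ; _≤_          = _≤_
  ; ≤-isPreorder = ≤-isPreorder
  ; +-mono-≤     = λ {x} {y} {u} {v} → +ᴿ-mono-≤ x y u v
  ; dist         = λ x y → ∣ x - y ∣
  ; dist-refl    = λ x m → cong ℚ.∣_∣ (ℚ.+-inverseʳ (seq x m))
  ; dist-comm    = λ x y m → ∣p-q∣≡∣q-p∣ (seq x m) (seq y m)
  ; dist-triangle = ∣-∣-triangle
  ; 0≤dist       = λ x y → pointwise-≤ 0ℝ ∣ x - y ∣ (0≤seq-∣∣ (x - y))
  ; x-y≤dist     = λ x y → x≤∣x∣ (x + (- y))
  }

-- Nonnegativity of envy, and the passage from 3 to 7/2.

0≤seq-+ : ∀ x y m → 0ℚ ℚ.≤ seq x m → 0ℚ ℚ.≤ seq y m → 0ℚ ℚ.≤ seq (x + y) m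
0≤seq-+ x y m = ℚ.+-mono-≤ {0ℚ} {seq x m} {0ℚ} {seq y m}

0≤seq-sum : ∀ {A : Set} (f : A → ℝ) m → (∀ a → 0ℚ ℚ.≤ seq (f a) m) →
  ∀ as → 0ℚ ℚ.≤ seq (sum (List.map f as)) m
0≤seq-sum f m 0≤f []       = ℚ.≤-refl
0≤seq-sum f m 0≤f (a ∷ as) =
  0≤seq-+ (f a) (sum (List.map f as)) m (0≤f a) (0≤seq-sum f m 0≤f as)

-- Absolute values are taken termwise, so every term of the sequence is nonnegative, not only the
-- limit; multiples of envy can thus be compared termwise.
0≤seq-Envy : ∀ {n} G (h : Fin n → ℝ) (π : Allocation G n) m → 0ℚ ℚ.≤ seq (Envy G h π) m
0≤seq-Envy G h π m = 0≤seq-sum (λ (u , v) → ∣ h (to u) - h (to v) ∣) m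
  (λ (u , v) → 0≤seq-∣∣ (h (to u) - h (to v)) m) (edges G)
  where open Bijection π using (to)

-- The left side is the form to which each term of `3 ×ᵣ x` unfolds.
3p≤7/2p : ∀ p → 0ℚ ℚ.≤ p → p ℚ.+ (p ℚ.+ (p ℚ.+ 0ℚ)) ℚ.≤ (+ 7 / 2) ℚ.* p
3p≤7/2p p 0≤p = begin
  p ℚ.+ (p ℚ.+ (p ℚ.+ 0ℚ))
    ≡⟨ solve 1 (λ p → p :+ (p :+ (p :+ con 0ℚ)) := con (+ 3 / 1) :* p) refl p ⟩
  (+ 3 / 1) ℚ.* p
    ≤⟨ ℚ.*-monoʳ-≤-nonNeg p {{ℚ.nonNegative 0≤p}} {+ 3 / 1} {+ 7 / 2}
        -- Cross-multiplied, 3/1 ≤ 7/2 becomes 6 ≤ 7.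
        (ℚ.*≤* (ℤ.+≤+ (ℕ.m≤m+n 6 1))) ⟩
  (+ 7 / 2) ℚ.* p ∎
  where
  open ℚ.≤-Reasoning
  open +-*-Solver using (solve; _:=_; _:+_; _:*_; con)

3×x≤7/2·x : ∀ x → (∀ m → 0ℚ ℚ.≤ seq x m) → 3 ×ᵣ x ≤ (+ 7 / 2) · x
3×x≤7/2·x x 0≤x = pointwise-≤ (3 ×ᵣ x) ((+ 7 / 2) · x) λ m → 3p≤7/2p (seq x m) (0≤x m)

theorem5p5 : (k : ℕ) (h : Fin (size k) → ℝ) →
    (∀ i → 0ℝ ≤ h i) →
    (∀ i j → i Fin.≤ j → h i ≤ h j) →
    (π′ : Allocation (B k) (size k)) →
    Envy (B k) h (inorderAllocation k) ≤ (+ 7 / 2) · Envy (B k) h π′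
theorem5p5 k h _ sorted π′ =
  ≤ᴿ-trans (Envy (B k) h (inorderAllocation k)) (3 ×ᵣ Envy (B k) h π′) ((+ 7 / 2) · Envy (B k) h π′)
    (Layers.envy-mono ℝ-metricGroup 3 h
      (Bijection.to (inorderAllocation k)) (Bijection.to π′) (treeEdges k)
      (λ i j i≤j → x≤y⇒∣y-x∣≤y-x (h i) (h j) (sorted i j i≤j))
      (λ c≤ → cut-inorder-optimal k c≤ π′))
    (3×x≤7/2·x (Envy (B k) h π′) (0≤seq-Envy (B k) h π′))
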